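{- Let $G$ be a graph satisfying $\omega(G) \geq \frac{3}{4}(\Delta(G) + 1)$. Then $G$ has an independent set $I$ such that $\omega(G - I) < \omega(G)$.
   Context: Graphs are finite, simple and undirected. $\omega(G)$ denotes the clique number of $G$ (the number of vertices in a largest clique; it is $0$ for the graph with no vertices), $\Delta(G)$ denotes the maximum degree of $G$, and $G - I$ denotes the subgraph of $G$ induced on $V(G) \setminus I$. -}

module Defs where

open import Data.Fin using (Fin; _≟_)
open import Data.Fin.Properties using (all?)
open import Data.Fin.Subset using (Subset; inside; outside; _∈_; _⊆_; _─_; ∣_∣; ⊥)
open import Data.Fin.Subset.Properties using (_∈?_; _⊆?_; ⊥⊆; ∉⊥; ∣⊥∣≡0)
open import Data.List using (List; []; _∷_; _++_; map; filter; allFin)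
open import Data.List.Extrema.Nat using (max; xs≤max; argmax-sel)
import Data.List.Membership.Propositional as List
open import Data.List.Membership.Propositional.Properties
  using (∈-map⁺; ∈-map⁻; ∈-++⁺ˡ; ∈-++⁺ʳ; ∈-filter⁺; ∈-filter⁻)
open import Data.List.Relation.Unary.Any using (here)
import Data.List.Relation.Unary.All as All
open import Data.Nat using (ℕ; zero; suc; _≤_)
open import Data.Product using (_×_; _,_; proj₁; proj₂; ∃-syntax)
open import Data.Sum using (inj₁; inj₂)
open import Data.Vec using ([]; _∷_; tabulate)
open import Function using (id)
open import Level using (0ℓ)
open import Relation.Binary using (Rel; Decidable; Symmetric)
open import Relation.Binary.PropositionalEquality using (_≡_; _≢_; refl; sym; trans)
open import Relation.Nullary using (Dec; ¬_; does; contradiction)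
open import Relation.Nullary.Decidable using (¬?; _×-dec_; _→-dec_)

-- The vertex set is a subset of an ambient Fin n, so that deleting
-- vertices leaves the type of vertices unchanged.  Every finite simple
-- graph is isomorphic to one of this form.
record Graph (n : ℕ) : Set₁ where
  infix 4 _~_ _~?_
  field
    V        : Subset n
    _~_      : Rel (Fin n) 0ℓ
    _~?_     : Decidable _~_
    ~-sym    : Symmetric _~_
    ~-irrefl : ∀ {v} → ¬ (v ~ v)
    ~⇒∈V     : ∀ {u v} → u ~ v → u ∈ V

open Graph using (V)

module _ {n : ℕ} (G : Graph n) where
  open Graph G using (_~_; _~?_)

  IsClique : Subset n → Set
  IsClique C = C ⊆ V G × (∀ u v → u ∈ C → v ∈ C → u ≢ v → u ~ v)

  IsIndependent : Subset n → Set
  IsIndependent I = I ⊆ V G × (∀ u v → u ∈ I → v ∈ I → ¬ (u ~ v))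

  isClique? : ∀ C → Dec (IsClique C)
  isClique? C = (C ⊆? V G) ×-dec
    all? λ u → all? λ v →
      (u ∈? C) →-dec ((v ∈? C) →-dec (¬? (u ≟ v) →-dec (u ~? v)))

  neighbours : Fin n → Subset n
  neighbours v = tabulate λ u → does (v ~? u)

  degree : Fin n → ℕ
  degree v = ∣ neighbours v ∣

subsets : ∀ n → List (Subset n)
subsets zero    = [] ∷ []
subsets (suc n) = map (inside ∷_) (subsets n) ++ map (outside ∷_) (subsets n)

-- In max b xs the number b is the value for empty xs; thus Δ is 0 for
-- the graph with no vertices.
ω : ∀ {n} → Graph n → ℕ
ω {n} G = max 0 (map ∣_∣ (filter (isClique? G) (subsets n)))

Δ : ∀ {n} → Graph n → ℕ
Δ {n} G = max 0 (map (degree G) (filter (_∈? V G) (allFin n)))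

infixl 6 _-_

_-_ : ∀ {n} → Graph n → Subset n → Graph n
G - I = record
  { V        = W
  ; _~_      = λ u v → u ~ v × u ∈ W × v ∈ W
  ; _~?_     = λ u v → (u ~? v) ×-dec ((u ∈? W) ×-dec (v ∈? W))
  ; ~-sym    = λ (u~v , u∈W , v∈W) → ~-sym u~v , v∈W , u∈W
  ; ~-irrefl = λ (v~v , _) → ~-irrefl v~v
  ; ~⇒∈V     = λ (_ , u∈W , _) → u∈W
  }
  where
  open Graph G using (_~_; _~?_; ~-sym; ~-irrefl)
  W = V G ─ I

∈-subsets : ∀ {n} (S : Subset n) → S List.∈ subsets n
∈-subsets []            = here refl
∈-subsets (inside  ∷ S) = ∈-++⁺ˡ (∈-map⁺ (inside ∷_) (∈-subsets S))
∈-subsets (outside ∷ S) = ∈-++⁺ʳ (map (inside ∷_) (subsets _)) (∈-map⁺ (outside ∷_) (∈-subsets S))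

ω-upper : ∀ {n} (G : Graph n) {C} → IsClique G C → ∣ C ∣ ≤ ω G
ω-upper G {C} cl =
  All.lookup (xs≤max 0 _) (∈-map⁺ ∣_∣ (∈-filter⁺ (isClique? G) (∈-subsets C) cl))

ω-attained : ∀ {n} (G : Graph n) → ∃[ C ] IsClique G C × ∣ C ∣ ≡ ω G
ω-attained {n} G with argmax-sel id 0 (map ∣_∣ (filter (isClique? G) (subsets n)))
... | inj₁ ω≡0 =
  ⊥ , (⊥⊆ , λ _ _ u∈⊥ → contradiction u∈⊥ ∉⊥) , trans (∣⊥∣≡0 n) (sym ω≡0)
... | inj₂ ω∈ with ∈-map⁻ ∣_∣ ω∈
...   | C , C∈ , ω≡∣C∣ = C , proj₂ (∈-filter⁻ (isClique? G) {xs = subsets n} C∈) , sym ω≡∣C∣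

{-# OPTIONS --safe #-}
module Submission where

-- Write w for the clique number, D for the maximum degree plus one, and call
-- a clique maximum if it has w vertices.  It suffices to find an independent
-- set that meets every maximum clique.
--
-- Hajnal's inequality (hajnal) says that the common part and the union of a
-- nonempty family of maximum cliques have together at least 2w vertices.  If
-- the common part is nonempty, then a vertex in it is adjacent to all the rest
-- of the union, so the union has at most D vertices and the common part at
-- least 2w - D.  In particular two maximum cliques that meet share at least
-- 2w - D vertices.  Since 2D < 3w this is more than w / 2, so two such intersections
-- within the same clique overlap: meeting is an equivalence relation on maximum
-- cliques (Meets-trans).  By induction on the family, the maximum cliques in one
-- equivalence class have a common vertex (⋂-nonempty), so their common part, the
-- kernel of the class, has at least 2w - D vertices (kernel-large).
--
-- A set of one vertex from every kernel meets every maximum clique.  It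
-- remains to choose these vertices pairwise nonadjacent.  Two vertices from
-- different kernels never lie in a common maximum clique, so only the edges
-- outside maximum cliques matter.  A vertex of a maximum clique is on at most
-- D - w of those (outerDegree), and 2(D - w) ≤ 2w - D is the hypothesis
-- 3D ≤ 4w.  So the vertices exist by Haxell's theorem
-- (independentTransversal): pairwise disjoint nonempty sets of at least 2d
-- vertices, each of degree at most d, have an independent transversal.
--
-- Haxell's theorem is proved by strengthening it (extend): given an
-- independent transversal T of some of the sets, a set U of vertices of degree
-- at most d disjoint from these sets, and a sufficiently smaller forbidden set X
-- avoided by T, there is an independent transversal of the same sets avoiding
-- X, together with a vertex of U outside X that is adjacent to none of it.  Pick
-- x in U outside X, and a list of k of the sets that includes all those whose
-- representative is adjacent to x; at the start, all of them.  If k = 0, then T and x are as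
-- wanted.  Otherwise merge the listed sets into U, and forbid the neighbours of
-- x and of their representatives; this adds at least 2kd vertices to U, and at
-- most (k + 1)d to X.  By induction the remaining sets have a new transversal,
-- with a vertex z of the enlarged U.  Either z is in U, and the old
-- representatives of the merged sets complete the extension, or z replaces one
-- of them and, not being adjacent to x, makes the list shorter.

open import Defs
open import Data.Bool using (true)
open import Data.Fin using (Fin; zero; suc; _≟_)
open import Data.Fin.Properties using (any?)
open import Data.Fin.Subset
  using (Subset; inside; outside; Nonempty; Empty; _∈_; _∉_; _⊆_; _∪_; _∩_; _─_; ⋃; ⋂; ⁅_⁆; ∣_∣; ⊥)
open import Data.Fin.Subset.Properties
open import Data.List using (List; []; _∷_; _++_; length; map; filter; allFin)
open import Data.List.Extrema.Nat using (xs≤max)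
import Data.List.Membership.DecPropositional as DecMembership
import Data.List.Membership.Propositional as List
open import Data.List.Membership.Propositional.Properties
  using (∈-map⁺; ∈-map⁻; ∈-++⁺ˡ; ∈-++⁺ʳ; ∈-++⁻; ∈-∃++; ∈-allFin; ∈-filter⁺; ∈-filter⁻)
open import Data.List.Relation.Binary.Permutation.Propositional
  using (_↭_; ↭-sym; ↭-trans; ↭-reflexive; ↭⇒↭ₛ)
open import Data.List.Relation.Binary.Permutation.Propositional.Properties
  using (↭-length; ∈-resp-↭; shift; ++⁺ʳ)
import Data.List.Relation.Binary.Permutation.Setoid.Properties as Permutation
open import Data.List.Relation.Unary.All as All using (All; []; _∷_)
open import Data.List.Relation.Unary.Any using (here; there)
open import Data.List.Relation.Unary.AllPairs using ([]; _∷_)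
open import Data.List.Relation.Unary.Unique.Propositional using (Unique)
open import Data.List.Relation.Unary.Unique.Propositional.Properties
  using (allFin⁺)
import Data.List.Properties as Listₚ
open import Data.Nat as ℕ using (ℕ; zero; suc; _+_; _*_; _∸_; _≤_; _<_; _≥_; z≤n; s≤s)
open import Data.Nat.Induction using (Acc; acc; <-wellFounded)
open import Data.Nat.Properties hiding (_≟_)
open import Data.Nat.Tactic.RingSolver using (solve-∀)
open import Data.Product using (_×_; _,_; proj₁; proj₂; ∃-syntax)
open import Data.Sum using (_⊎_; inj₁; inj₂; [_,_]′)
open import Data.Vec as Vec using ([]; _∷_)
open import Data.Vec.Properties using (lookup∘tabulate; []=⇒lookup; lookup⇒[]=)
open import Function using (_∘_; _$_)
open import Relation.Binary.PropositionalEquality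
open import Relation.Nullary using (Dec; yes; no; does; ¬_; contradiction)
open import Relation.Nullary.Decidable using (¬?; _×-dec_; dec-true)

private variable
  n r : ℕ

-- Cardinalities, unions and intersections of finite sets

∣p∪q∣+∣p∩q∣≡∣p∣+∣q∣ : (p q : Subset n) → ∣ p ∪ q ∣ + ∣ p ∩ q ∣ ≡ ∣ p ∣ + ∣ q ∣
∣p∪q∣+∣p∩q∣≡∣p∣+∣q∣ []            []            = refl
∣p∪q∣+∣p∩q∣≡∣p∣+∣q∣ (outside ∷ p) (outside ∷ q) = ∣p∪q∣+∣p∩q∣≡∣p∣+∣q∣ p q
∣p∪q∣+∣p∩q∣≡∣p∣+∣q∣ (outside ∷ p) (inside  ∷ q) =
  trans (cong suc (∣p∪q∣+∣p∩q∣≡∣p∣+∣q∣ p q)) (sym (+-suc ∣ p ∣ ∣ q ∣))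
∣p∪q∣+∣p∩q∣≡∣p∣+∣q∣ (inside  ∷ p) (outside ∷ q) = cong suc (∣p∪q∣+∣p∩q∣≡∣p∣+∣q∣ p q)
∣p∪q∣+∣p∩q∣≡∣p∣+∣q∣ (inside  ∷ p) (inside  ∷ q) = cong suc $
  trans (+-suc ∣ p ∪ q ∣ ∣ p ∩ q ∣)
    (trans (cong suc (∣p∪q∣+∣p∩q∣≡∣p∣+∣q∣ p q)) (sym (+-suc ∣ p ∣ ∣ q ∣)))

∣p∪q∣≤∣p∣+∣q∣ : (p q : Subset n) → ∣ p ∪ q ∣ ≤ ∣ p ∣ + ∣ q ∣
∣p∪q∣≤∣p∣+∣q∣ p q =
  ≤-trans (m≤m+n ∣ p ∪ q ∣ ∣ p ∩ q ∣) (≤-reflexive (∣p∪q∣+∣p∩q∣≡∣p∣+∣q∣ p q))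

disjoint⇒∣p∪q∣≡∣p∣+∣q∣ : (p q : Subset n) → (∀ {v} → v ∈ p → v ∉ q) →
                         ∣ p ∪ q ∣ ≡ ∣ p ∣ + ∣ q ∣
disjoint⇒∣p∪q∣≡∣p∣+∣q∣ {n} p q disj = begin
  ∣ p ∪ q ∣              ≡⟨ +-identityʳ _ ⟨
  ∣ p ∪ q ∣ + 0          ≡⟨ cong (∣ p ∪ q ∣ +_) ∣p∩q∣≡0 ⟨
  ∣ p ∪ q ∣ + ∣ p ∩ q ∣  ≡⟨ ∣p∪q∣+∣p∩q∣≡∣p∣+∣q∣ p q ⟩
  ∣ p ∣ + ∣ q ∣          ∎
  where
  open ≡-Reasoning
  empty : Empty (p ∩ q)
  empty (v , v∈) = let v∈p , v∈q = x∈p∩q⁻ p q v∈ in disj v∈p v∈q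
  ∣p∩q∣≡0 : ∣ p ∩ q ∣ ≡ 0
  ∣p∩q∣≡0 = trans (cong ∣_∣ (Empty-unique empty)) (∣⊥∣≡0 n)

∣p∣<∣q∣⇒∃q∖p : (p q : Subset n) → ∣ p ∣ < ∣ q ∣ → ∃[ v ] v ∈ q × v ∉ p
∣p∣<∣q∣⇒∃q∖p p q p<q with any? (λ v → (v ∈? q) ×-dec ¬? (v ∈? p))
... | yes ∃v = ∃v
... | no ∄v  = contradiction (p⊆q⇒∣p∣≤∣q∣ q⊆p) (<⇒≱ p<q)
  where
  q⊆p : q ⊆ p
  q⊆p {v} v∈q with v ∈? p
  ... | yes v∈p = v∈p
  ... | no v∉p  = contradiction (v , v∈q , v∉p) ∄v

0<∣p∣⇒Nonempty : (p : Subset n) → 0 < ∣ p ∣ → Nonempty p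
0<∣p∣⇒Nonempty {n} p 0<p =
  let v , v∈p , _ = ∣p∣<∣q∣⇒∃q∖p ⊥ p (subst (_< ∣ p ∣) (sym (∣⊥∣≡0 n)) 0<p) in v , v∈p

∈-⋃⁺ : {v : Fin n} {p : Subset n} {ps : List (Subset n)} → p List.∈ ps → v ∈ p → v ∈ ⋃ ps
∈-⋃⁺ {ps = p ∷ ps} (here refl) v∈p = p⊆p∪q (⋃ ps) v∈p
∈-⋃⁺ {ps = q ∷ ps} (there p∈)  v∈p = q⊆p∪q q (⋃ ps) (∈-⋃⁺ p∈ v∈p)

∈-⋃⁻ : {v : Fin n} (ps : List (Subset n)) → v ∈ ⋃ ps → ∃[ p ] p List.∈ ps × v ∈ p
∈-⋃⁻ []       v∈ = contradiction v∈ ∉⊥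
∈-⋃⁻ (p ∷ ps) v∈ with x∈p∪q⁻ p (⋃ ps) v∈
... | inj₁ v∈p = p , here refl , v∈p
... | inj₂ v∈⋃ = let q , q∈ , v∈q = ∈-⋃⁻ ps v∈⋃ in q , there q∈ , v∈q

∈-⋃-map⁻ : {A : Set} {v : Fin n} (f : A → Subset n) (xs : List A) →
           v ∈ ⋃ (map f xs) → ∃[ x ] x List.∈ xs × v ∈ f x
∈-⋃-map⁻ f xs v∈ with ∈-⋃⁻ (map f xs) v∈
... | _ , p∈ , v∈p with ∈-map⁻ f p∈
...   | x , x∈ , refl = x , x∈ , v∈p

∈-⋂⁻ : {v : Fin n} {p : Subset n} {ps : List (Subset n)} → v ∈ ⋂ ps → p List.∈ ps → v ∈ p
∈-⋂⁻ {ps = p ∷ ps} v∈ (here refl) = p∩q⊆p p (⋂ ps) v∈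
∈-⋂⁻ {ps = q ∷ ps} v∈ (there p∈)  = ∈-⋂⁻ (p∩q⊆q q (⋂ ps) v∈) p∈

x∈p─q⇒x∉q : {v : Fin n} {p q : Subset n} → v ∈ p ─ q → v ∉ q
x∈p─q⇒x∉q {p = _ ∷ _} {inside ∷ _} ()              Vec.here
x∈p─q⇒x∉q {p = _ ∷ _} {_      ∷ _} (Vec.there v∈p) (Vec.there v∈q) = x∈p─q⇒x∉q v∈p v∈q

-- Lists without repetition

module _ {A : Set} where

  Unique-++⁻ : ∀ (xs : List A) {ys} → Unique (xs ++ ys) →
               Unique xs × Unique ys × (∀ {x} → x List.∈ xs → ¬ x List.∈ ys)
  Unique-++⁻ []       u        = [] , u , λ ()
  Unique-++⁻ (x ∷ xs) (x≢ ∷ u) =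
    let uxs , uys , xs#ys = Unique-++⁻ xs u in
    All.tabulate (λ z∈xs → All.lookup x≢ (∈-++⁺ˡ z∈xs)) ∷ uxs , uys ,
    λ { (here refl) x∈ys → All.lookup x≢ (∈-++⁺ʳ xs x∈ys) refl
      ; (there z∈)  z∈ys → xs#ys z∈ z∈ys }

  Unique-resp-↭ : {xs ys : List A} → xs ↭ ys → Unique xs → Unique ys
  Unique-resp-↭ xs↭ys = Permutation.Unique-resp-↭ (setoid A) (↭⇒↭ₛ xs↭ys)

-- Neighbourhoods

module _ (G : Graph n) where
  open Graph G

  ∈-neighbours⁺ : ∀ {u v} → v ~ u → u ∈ neighbours G v
  ∈-neighbours⁺ {u} {v} v~u = lookup⇒[]= u _ (trans (lookup∘tabulate _ u) (dec-true (v ~? u) v~u))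

  ∈-neighbours⁻ : ∀ {u v} → u ∈ neighbours G v → v ~ u
  ∈-neighbours⁻ {u} {v} u∈ = witness (v ~? u) (trans (sym (lookup∘tabulate _ u)) ([]=⇒lookup u∈))
    where
    witness : {P : Set} (P? : Dec P) → does P? ≡ true → P
    witness (yes p) _ = p

  ∣⋃N∣≤ : ∀ d (vs : List (Fin n)) → (∀ {v} → v List.∈ vs → degree G v ≤ d) →
          ∣ ⋃ (map (neighbours G) vs) ∣ ≤ length vs * d
  ∣⋃N∣≤ d []       deg≤ = ≤-reflexive (∣⊥∣≡0 n)
  ∣⋃N∣≤ d (v ∷ vs) deg≤ = ≤-trans (∣p∪q∣≤∣p∣+∣q∣ (neighbours G v) _)
    (+-mono-≤ (deg≤ (here refl)) (∣⋃N∣≤ d vs (deg≤ ∘ there)))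

-- Changing a family of representatives at some indices

module _ {r : ℕ} {A : Set} where
  open DecMembership (_≟_ {r}) using () renaming (_∈?_ to _∈ₗ?_)

  -- The family that agrees with T′ on the indices in B and with T elsewhere.
  _[_≔_] : (Fin r → A) → List (Fin r) → (Fin r → A) → Fin r → A
  (T [ B ≔ T′ ]) i with i ∈ₗ? B
  ... | yes _ = T′ i
  ... | no _  = T i

  -- Reasoning about a value of T [ B ≔ T′ ] splits on membership of the index.
  ≔-elim : (P : A → Set) {T T′ : Fin r → A} (B : List (Fin r)) (i : Fin r) →
           (i List.∈ B → P (T′ i)) → (¬ i List.∈ B → P (T i)) → P ((T [ B ≔ T′ ]) i)
  ≔-elim P B i new old with i ∈ₗ? B
  ... | yes i∈B = new i∈B
  ... | no i∉B  = old i∉B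

-- Haxell's theorem on independent transversals

module Transversals
  (H : Graph n) (V : Fin r → Subset n)
  (disjoint : ∀ {i j v} → i ≢ j → v ∈ V i → v ∉ V j)
  (d s : ℕ) (2d≤s : d + d ≤ s) (0<s : 0 < s)
  (large : ∀ i → s ≤ ∣ V i ∣)
  (degree≤d : ∀ {i v} → v ∈ V i → degree H v ≤ d)
  where
  open Graph H using (_~_; ~-sym; ~-irrefl)

  -- The vertices T i, for i in A, form an independent transversal of the sets
  -- V i, for i in A, and avoid X.  The values of T outside A are irrelevant.
  record PartialTransversal (A : List (Fin r)) (X : Subset n) (T : Fin r → Fin n) : Set where
    field
      member      : ∀ {i} → i List.∈ A → T i ∈ V i
      avoids      : ∀ {i} → i List.∈ A → T i ∉ X
      independent : ∀ {i j} → i List.∈ A → j List.∈ A → ¬ (T i ~ T j)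

  open PartialTransversal

  -- An independent transversal of the sets with index in A and one further
  -- vertex, in U, that is adjacent to none of it; all of them avoid X.
  Extension : List (Fin r) → Subset n → Subset n → Set
  Extension A U X = ∃[ T ] ∃[ z ] PartialTransversal A X T × z ∈ U × z ∉ X ×
                    (∀ {i} → i List.∈ A → ¬ (z ~ T i))

  -- A vertex of V i nonadjacent to a partial transversal represents V i.
  adjoin : ∀ {A X T i z} → PartialTransversal A X T → z ∈ V i → z ∉ X →
           (∀ {j} → j List.∈ A → ¬ (z ~ T j)) →
           PartialTransversal (i ∷ A) X (T [ i ∷ [] ≔ (λ _ → z) ])
  adjoin {A} {X} {T} {i} {z} pt z∈V z∉X z≁T = record
    { member = λ {j} j∈ → ≔-elim (_∈ V j) (i ∷ []) j
        (λ { (here refl) → z∈V }) (λ j∉ → member pt (rest j∈ j∉))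
    ; avoids = λ {j} j∈ → ≔-elim (_∉ X) (i ∷ []) j
        (λ _ → z∉X) (λ j∉ → avoids pt (rest j∈ j∉))
    ; independent = λ {j} {k} j∈ k∈ →
        ≔-elim (λ v → ¬ (v ~ (T [ i ∷ [] ≔ (λ _ → z) ]) k)) (i ∷ []) j
          (λ _  → ≔-elim (λ v → ¬ (z ~ v)) (i ∷ []) k
             (λ _ → ~-irrefl) (λ k∉ → z≁T (rest k∈ k∉)))
          (λ j∉ → ≔-elim (λ v → ¬ (T j ~ v)) (i ∷ []) k
             (λ _ → z≁T (rest j∈ j∉) ∘ ~-sym)
             (λ k∉ → independent pt (rest j∈ j∉) (rest k∈ k∉)))
    }
    where
    rest : ∀ {j} → j List.∈ i ∷ A → ¬ j List.∈ i ∷ [] → j List.∈ A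
    rest (here j≡i)  j∉ = contradiction (here j≡i) j∉
    rest (there j∈A) _  = j∈A

  -- Overwriting T by T′ on B stays independent when T′ avoids the neighbours of
  -- every representative T i that is kept.
  merge : ∀ {A K B X Y T T′} →
          (∀ {i} → i List.∈ A → i List.∈ K ⊎ i List.∈ B) →
          X ⊆ Y → (∀ {i v} → i List.∈ K → T i ~ v → v ∈ Y) →
          PartialTransversal A X T → PartialTransversal B Y T′ →
          PartialTransversal A X (T [ B ≔ T′ ])
  merge {A} {K} {B} {X} {Y} {T} {T′} split X⊆Y N⊆Y pt pt′ = record
    { member = λ {i} i∈ → ≔-elim (_∈ V i) B i (member pt′) (λ _ → member pt i∈)
    ; avoids = λ {i} i∈ → ≔-elim (_∉ X) B i (λ i∈B → avoids pt′ i∈B ∘ X⊆Y) (λ _ → avoids pt i∈)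
    ; independent = λ {i} {j} i∈ j∈ →
        ≔-elim (λ v → ¬ (v ~ (T [ B ≔ T′ ]) j)) B i
          (λ i∈B → ≔-elim (λ v → ¬ (T′ i ~ v)) B j
             (independent pt′ i∈B)
             (λ j∉B → avoids pt′ i∈B ∘ N⊆Y (inK j∈ j∉B) ∘ ~-sym))
          (λ i∉B → ≔-elim (λ v → ¬ (T i ~ v)) B j
             (λ j∈B → avoids pt′ j∈B ∘ N⊆Y (inK i∈ i∉B))
             (λ _ → independent pt i∈ j∈))
    }
    where
    inK : ∀ {i} → i List.∈ A → ¬ i List.∈ B → i List.∈ K
    inK i∈A i∉B = [ (λ i∈K → i∈K) , (λ i∈B → contradiction i∈B i∉B) ]′ (split i∈A)

  ∣⋃V∣≥ : ∀ K → Unique K → length K * s ≤ ∣ ⋃ (map V K) ∣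
  ∣⋃V∣≥ []      _        = z≤n
  ∣⋃V∣≥ (i ∷ K) (i≢ ∷ u) = begin
    s + length K * s               ≤⟨ +-mono-≤ (large i) (∣⋃V∣≥ K u) ⟩
    ∣ V i ∣ + ∣ ⋃ (map V K) ∣      ≡⟨ disjoint⇒∣p∪q∣≡∣p∣+∣q∣ (V i) _ Vi#⋃ ⟨
    ∣ V i ∪ ⋃ (map V K) ∣          ∎
    where
    open ≤-Reasoning
    Vi#⋃ : ∀ {v} → v ∈ V i → v ∉ ⋃ (map V K)
    Vi#⋃ v∈Vi v∈⋃ =
      let j , j∈K , v∈Vj = ∈-⋃-map⁻ V K v∈⋃ in disjoint (All.lookup i≢ j∈K) v∈Vi v∈Vj

  -- U may serve as one more set next to the sets with index in A, and has at
  -- least s more vertices than X.  The bound on X is the invariant from which a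
  -- vertex of U outside X is always available.
  Admissible : List (Fin r) → Subset n → Subset n → Set
  Admissible A U X =
    Unique A × (∀ {i v} → i List.∈ A → v ∈ U → v ∉ V i) ×
    (∀ {v} → v ∈ U → degree H v ≤ d) × s + ∣ X ∣ ≤ ∣ U ∣

  -- The extension property for A, for all choices of U and X and all partial
  -- transversals; the induction is on the length of A.
  Extendable : List (Fin r) → Set
  Extendable A = ∀ {U X} → Admissible A U X → ∀ {T} → PartialTransversal A X T → Extension A U X

  -- The step of Haxell's argument for a fixed vertex x of U.  The list K
  -- contains the indices of all representatives that may be adjacent to x, and B
  -- the others.  Each pass either finishes or moves an index from K to B.
  exchange : ∀ {A U X x} → Admissible A U X → x ∈ U → x ∉ X →
             (∀ {B} → length B < length A → Extendable B) →
             ∀ K B → Acc _<_ (length K) → A ↭ K ++ B →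
             ∀ {T} → PartialTransversal A X T → (∀ {i} → i List.∈ B → ¬ (x ~ T i)) →
             Extension A U X
  exchange {x = x} adm x∈U x∉X shorter [] B _ A↭B {T} pt x≁ =
    T , x , pt , x∈U , x∉X , x≁ ∘ ∈-resp-↭ A↭B
  exchange {A} {U} {X} {x} adm@(uA , U#V , deg≤d , s+X≤U) x∈U x∉X shorter
    K@(_ ∷ ks) B (acc rec) A↭ {T} pt x≁ =
    let T′ , z , pt′ , z∈U₁ , z∉X₁ , z≁ = shorter B<A adm₁ ptB in
    [ (λ z∈K → replace pt′ (∈-⋃-map⁻ V K z∈K) z∉X₁ z≁)
    , (λ z∈U → T [ B ≔ T′ ] , z , merge split X⊆X₁ NT⊆X₁ pt pt′ , z∈U , z∉X₁ ∘ X⊆X₁ ,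
        λ {i} i∈A → ≔-elim (λ v → ¬ (z ~ v)) B i z≁
          λ i∉B → [ (λ i∈K → z∉X₁ ∘ NT⊆X₁ i∈K ∘ ~-sym) , (λ i∈B → contradiction i∈B i∉B) ]′ (split i∈A))
    ]′ (x∈p∪q⁻ (⋃ (map V K)) U z∈U₁)
    where
    open ≤-Reasoning
    -- The sets with index in K are merged into U, and the neighbours of x and of
    -- their representatives are forbidden.
    U₁ = ⋃ (map V K) ∪ U
    X₁ = ⋃ (map (neighbours H) (x ∷ map T K)) ∪ X

    uB : Unique B
    uB = proj₁ (proj₂ (Unique-++⁻ K (Unique-resp-↭ A↭ uA)))

    uK : Unique K
    uK = proj₁ (Unique-++⁻ K (Unique-resp-↭ A↭ uA))

    K#B : ∀ {i} → i List.∈ K → ¬ i List.∈ B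
    K#B = proj₂ (proj₂ (Unique-++⁻ K (Unique-resp-↭ A↭ uA)))

    B⊆A : ∀ {i} → i List.∈ B → i List.∈ A
    B⊆A i∈B = ∈-resp-↭ (↭-sym A↭) (∈-++⁺ʳ K i∈B)

    K⊆A : ∀ {i} → i List.∈ K → i List.∈ A
    K⊆A i∈K = ∈-resp-↭ (↭-sym A↭) (∈-++⁺ˡ i∈K)

    split : ∀ {i} → i List.∈ A → i List.∈ K ⊎ i List.∈ B
    split i∈A = ∈-++⁻ K (∈-resp-↭ A↭ i∈A)

    X⊆X₁ : X ⊆ X₁
    X⊆X₁ = q⊆p∪q _ X

    N⊆X₁ : ∀ {u v} → u List.∈ x ∷ map T K → u ~ v → v ∈ X₁
    N⊆X₁ u∈ u~v = p⊆p∪q X (∈-⋃⁺ (∈-map⁺ (neighbours H) u∈) (∈-neighbours⁺ H u~v))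

    NT⊆X₁ : ∀ {i v} → i List.∈ K → T i ~ v → v ∈ X₁
    NT⊆X₁ i∈K = N⊆X₁ (there (∈-map⁺ T i∈K))

    B<A : length B < length A
    B<A = begin
      suc (length B)         ≤⟨ s≤s (m≤n+m (length B) (length ks)) ⟩
      length K + length B    ≡⟨ Listₚ.length-++ K ⟨
      length (K ++ B)        ≡⟨ ↭-length A↭ ⟨
      length A               ∎

    K#U : ∀ {v} → v ∈ ⋃ (map V K) → v ∉ U
    K#U v∈⋃ v∈U = let i , i∈K , v∈V = ∈-⋃-map⁻ V K v∈⋃ in U#V (K⊆A i∈K) v∈U v∈V

    deg≤ : ∀ {v} → v List.∈ x ∷ map T K → degree H v ≤ d
    deg≤ (here refl) = deg≤d x∈U
    deg≤ (there v∈)  with ∈-map⁻ T v∈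
    ... | i , i∈K , refl = degree≤d (member pt (K⊆A i∈K))

    -- With k = 1 + m merged sets, (k + 1)d ≤ 2kd ≤ ks; this uses k ≥ 1.
    count : ∀ m → (2 + m) * d ≤ (1 + m) * s
    count m = begin
      (2 + m) * d           ≤⟨ *-monoˡ-≤ d (s≤s (s≤s (m≤m+n m m))) ⟩
      (2 + (m + m)) * d     ≡⟨ lemma m d ⟩
      (1 + m) * (d + d)     ≤⟨ *-monoʳ-≤ (1 + m) 2d≤s ⟩
      (1 + m) * s           ∎
      where
      lemma : ∀ m d → (2 + (m + m)) * d ≡ (1 + m) * (d + d)
      lemma = solve-∀

    adm₁ : Admissible B U₁ X₁
    adm₁ = uB , U₁#V , deg₁ , (begin
      s + ∣ X₁ ∣
        ≤⟨ +-monoʳ-≤ s (∣p∪q∣≤∣p∣+∣q∣ (⋃ (map (neighbours H) (x ∷ map T K))) X) ⟩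
      s + (∣ ⋃ (map (neighbours H) (x ∷ map T K)) ∣ + ∣ X ∣)
        ≤⟨ +-monoʳ-≤ s (+-monoˡ-≤ ∣ X ∣ (∣⋃N∣≤ H d (x ∷ map T K) deg≤)) ⟩
      s + (length (x ∷ map T K) * d + ∣ X ∣)
        ≡⟨ cong (λ m → s + (suc m * d + ∣ X ∣)) (Listₚ.length-map T K) ⟩
      s + (suc (length K) * d + ∣ X ∣)
        ≤⟨ +-monoʳ-≤ s (+-monoˡ-≤ ∣ X ∣ (count (length ks))) ⟩
      s + (length K * s + ∣ X ∣)
        ≡⟨ lemma s (length K * s) ∣ X ∣ ⟩
      length K * s + (s + ∣ X ∣)
        ≤⟨ +-mono-≤ (∣⋃V∣≥ K uK) s+X≤U ⟩
      ∣ ⋃ (map V K) ∣ + ∣ U ∣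
        ≡⟨ disjoint⇒∣p∪q∣≡∣p∣+∣q∣ _ U K#U ⟨
      ∣ U₁ ∣ ∎)
      where
      lemma : ∀ a b c → a + (b + c) ≡ b + (a + c)
      lemma = solve-∀
      U₁#V : ∀ {i v} → i List.∈ B → v ∈ U₁ → v ∉ V i
      U₁#V i∈B v∈U₁ v∈Vi with x∈p∪q⁻ (⋃ (map V K)) U v∈U₁
      ... | inj₂ v∈U = U#V (B⊆A i∈B) v∈U v∈Vi
      ... | inj₁ v∈⋃ =
        let j , j∈K , v∈Vj = ∈-⋃-map⁻ V K v∈⋃ in disjoint (λ { refl → K#B j∈K i∈B }) v∈Vj v∈Vi

      deg₁ : ∀ {v} → v ∈ U₁ → degree H v ≤ d
      deg₁ v∈U₁ = [ (λ v∈⋃ → degree≤d (proj₂ (proj₂ (∈-⋃-map⁻ V K v∈⋃)))) , deg≤d ]′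
                  (x∈p∪q⁻ (⋃ (map V K)) U v∈U₁)

    ptB : PartialTransversal B X₁ T
    ptB = record
      { member      = member pt ∘ B⊆A
      ; avoids      = λ {i} i∈B Ti∈X₁ → [ avoidN i∈B , avoids pt (B⊆A i∈B) ]′ (x∈p∪q⁻ _ X Ti∈X₁)
      ; independent = λ i∈B j∈B → independent pt (B⊆A i∈B) (B⊆A j∈B)
      }
      where
      avoidN : ∀ {i} → i List.∈ B → T i ∉ ⋃ (map (neighbours H) (x ∷ map T K))
      avoidN i∈B Ti∈ with ∈-⋃-map⁻ (neighbours H) (x ∷ map T K) Ti∈
      ... | _ , here refl , Ti∈N = x≁ i∈B (∈-neighbours⁻ H Ti∈N)
      ... | _ , there v∈ , Ti∈N with ∈-map⁻ T v∈
      ...   | j , j∈K , refl = independent pt (K⊆A j∈K) (B⊆A i∈B) (∈-neighbours⁻ H Ti∈N)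

    -- The vertex z is not adjacent to x, so representing V i by z moves i to B.
    replace : ∀ {T′ z} → PartialTransversal B X₁ T′ → ∃[ i ] i List.∈ K × z ∈ V i → z ∉ X₁ →
              (∀ {i} → i List.∈ B → ¬ (z ~ T′ i)) → Extension A U X
    replace {T′} {z} pt′ (i , i∈K , z∈V) z∉X₁ z≁ with ∈-∃++ i∈K
    ... | ks₁ , ks₂ , K≡ =
      exchange adm x∈U x∉X shorter (ks₁ ++ ks₂) (i ∷ B) (rec K′<K) A↭′
        (merge (λ i∈A → [ inj₁ , inj₂ ∘ there ]′ (split i∈A)) X⊆X₁ NT⊆X₁ pt pt″)
        (λ {j} j∈ → ≔-elim (λ v → ¬ (x ~ v)) (i ∷ B) j
          (λ j∈ → avoids pt″ j∈ ∘ N⊆X₁ (here refl)) (contradiction j∈))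
      where
      pt″ = adjoin pt′ z∈V z∉X₁ z≁
      K↭ : K ↭ i ∷ ks₁ ++ ks₂
      K↭ = ↭-trans (↭-reflexive K≡) (shift i ks₁ ks₂)
      A↭′ : A ↭ (ks₁ ++ ks₂) ++ i ∷ B
      A↭′ = ↭-trans A↭ (↭-trans (++⁺ʳ B K↭) (↭-sym (shift i (ks₁ ++ ks₂) B)))
      K′<K : length (ks₁ ++ ks₂) < length K
      K′<K = ≤-reflexive (sym (↭-length K↭))

  -- Initially nothing is known about the neighbours of x, so K is all of A.
  extend : ∀ A → Acc _<_ (length A) → Extendable A
  extend A (acc rec) {U} {X} adm@(_ , _ , _ , s+X≤U) pt =
    let x , x∈U , x∉X = ∣p∣<∣q∣⇒∃q∖p X U (<-≤-trans (+-monoˡ-< ∣ X ∣ 0<s) s+X≤U) in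
    exchange adm x∈U x∉X (λ {B} B<A → extend B (rec B<A)) A [] (<-wellFounded (length A))
      (↭-reflexive (sym (Listₚ.++-identityʳ A))) pt λ ()

  -- Values for the indices not yet reached; only their existence matters.
  representative : Fin r → Fin n
  representative i = proj₁ (0<∣p∣⇒Nonempty (V i) (<-≤-trans 0<s (large i)))

  partialTransversal : ∀ A → Unique A → ∃[ T ] PartialTransversal A ⊥ T
  partialTransversal []      _ =
    representative , record { member = λ () ; avoids = λ () ; independent = λ () }
  partialTransversal (i ∷ A) (i≢ ∷ uA) =
    let _ , ptA = partialTransversal A uA
        T , z , pt , z∈V , z∉⊥ , z≁ = extend A (<-wellFounded (length A)) adm ptA
    in T [ i ∷ [] ≔ (λ _ → z) ] , adjoin pt z∈V z∉⊥ z≁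
    where
    adm : Admissible A (V i) ⊥
    adm = uA , (λ j∈A → disjoint (All.lookup i≢ j∈A)) , degree≤d ,
          ≤-trans (≤-reflexive (trans (cong (s +_) (∣⊥∣≡0 n)) (+-identityʳ s))) (large i)

  independentTransversal : ∃[ T ] (∀ i → T i ∈ V i) × (∀ i j → ¬ (T i ~ T j))
  independentTransversal =
    let T , pt = partialTransversal (allFin r) (allFin⁺ r) in
    T , (λ i → member pt (∈-allFin i)) , λ i j → independent pt (∈-allFin i) (∈-allFin j)

-- Arithmetic of the bound 3D ≤ 4w

module _ {w D : ℕ} where
  open ≤-Reasoning

  3D≤4w⇒2D<3w : 0 < D → 3 * D ≤ 4 * w → D + D < w + w + w
  3D≤4w⇒2D<3w 0<D 3D≤4w = *-cancelˡ-< 4 _ _ (begin-strict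
    4 * (D + D)          <⟨ m<m+n (4 * (D + D)) 0<D ⟩
    4 * (D + D) + D      ≡⟨ 8D+D≡9D D ⟩
    3 * (3 * D)          ≤⟨ *-monoʳ-≤ 3 3D≤4w ⟩
    3 * (4 * w)          ≡⟨ 12w≡4·3w w ⟩
    4 * (w + w + w)      ∎)
    where
    8D+D≡9D : ∀ D → 4 * (D + D) + D ≡ 3 * (3 * D)
    8D+D≡9D = solve-∀
    12w≡4·3w : ∀ w → 3 * (4 * w) ≡ 4 * (w + w + w)
    12w≡4·3w = solve-∀

  2[D∸w]≤2w∸D : w ≤ D → 3 * D ≤ 4 * w → (D ∸ w) + (D ∸ w) ≤ (w + w) ∸ D
  2[D∸w]≤2w∸D w≤D 3D≤4w = m+n≤o⇒m≤o∸n (d + d) (+-cancelˡ-≤ (w + w) _ _ (begin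
    (w + w) + ((d + d) + D)    ≡⟨ regroup w d D ⟩
    (w + d) + (w + d) + D      ≡⟨ cong (λ x → x + x + D) (m+[n∸m]≡n w≤D) ⟩
    D + D + D                  ≡⟨ 3D≡ D ⟩
    3 * D                      ≤⟨ 3D≤4w ⟩
    4 * w                      ≡⟨ 4w≡ w ⟩
    (w + w) + (w + w)          ∎))
    where
    d = D ∸ w
    regroup : ∀ w d D → (w + w) + ((d + d) + D) ≡ (w + d) + (w + d) + D
    regroup = solve-∀
    3D≡ : ∀ D → D + D + D ≡ 3 * D
    3D≡ = solve-∀
    4w≡ : ∀ w → 4 * w ≡ (w + w) + (w + w)
    4w≡ = solve-∀

  0<2w∸D : w ≤ D → D + D < w + w + w → 0 < (w + w) ∸ D
  0<2w∸D w≤D 2D<3w = m<n⇒0<n∸m (+-cancelʳ-< D _ _ (<-≤-trans 2D<3w (+-monoʳ-≤ (w + w) w≤D)))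

-- Representatives of the classes of a relation

-- A family of pairwise unrelated members of a list to which all members of the
-- list are related.  For an equivalence relation, one member of every class.
record Representatives {A : Set} (R : A → A → Set) (xs : List A) : Set where
  field
    size      : ℕ
    rep       : Fin size → A
    rep∈      : ∀ i → rep i List.∈ xs
    unrelated : ∀ {i j} → i ≢ j → ¬ R (rep i) (rep j)
    covers    : ∀ {x} → x List.∈ xs → ∃[ i ] R (rep i) x

representatives : {A : Set} {R : A → A → Set} → (∀ x y → Dec (R x y)) →
                  (∀ {x y} → R x y → R y x) →
                  (xs : List A) → (∀ {x} → x List.∈ xs → R x x) → Representatives R xs
representatives R? R-sym []       _      = record
  { size = 0 ; rep = λ () ; rep∈ = λ () ; unrelated = λ { {()} } ; covers = λ () }
representatives {A} {R} R? R-sym (x ∷ xs) R-refl = add (any? λ i → R? (rep i) x)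
  where
  open Representatives (representatives R? R-sym xs (R-refl ∘ there))

  add : Dec (∃[ i ] R (rep i) x) → Representatives R (x ∷ xs)
  add (yes (i , Rix)) = record
    { size      = size
    ; rep       = rep
    ; rep∈      = there ∘ rep∈
    ; unrelated = unrelated
    ; covers    = λ { (here refl) → i , Rix ; (there y∈) → covers y∈ }
    }
  add (no ∄i) = record
    { size      = suc size
    ; rep       = rep′
    ; rep∈      = λ { zero → here refl ; (suc i) → there (rep∈ i) }
    ; unrelated = λ {i} {j} → unrelated′ i j
    ; covers    = λ { (here refl) → zero , R-refl (here refl)
                    ; (there y∈)  → let i , Riy = covers y∈ in suc i , Riy }
    }
    where
    rep′ : Fin (suc size) → A
    rep′ zero    = x
    rep′ (suc i) = rep i

    unrelated′ : ∀ i j → i ≢ j → ¬ R (rep′ i) (rep′ j)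
    unrelated′ zero    zero    i≢j = contradiction refl i≢j
    unrelated′ zero    (suc j) _   = λ Rxj → ∄i (j , R-sym Rxj)
    unrelated′ (suc i) zero    _   = λ Rix → ∄i (i , Rix)
    unrelated′ (suc i) (suc j) i≢j = unrelated (i≢j ∘ cong suc)

-- Maximum cliques and Hajnal's inequality

module MaximumCliques (G : Graph n) where
  open Graph G

  D : ℕ
  D = Δ G + 1

  degree≤Δ : ∀ {v} → v ∈ V → degree G v ≤ Δ G
  degree≤Δ {v} v∈V =
    All.lookup (xs≤max 0 _) (∈-map⁺ (degree G) (∈-filter⁺ (_∈? V) (∈-allFin v) v∈V))

  dominated⇒∣p∣≤Δ+1 : ∀ {v} (p : Subset n) → v ∈ V → (∀ {u} → u ∈ p → v ≢ u → v ~ u) →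
                      ∣ p ∣ ≤ D
  dominated⇒∣p∣≤Δ+1 {v} p v∈V v~p = begin
    ∣ p ∣                          ≤⟨ p⊆q⇒∣p∣≤∣q∣ p⊆N[v] ⟩
    ∣ neighbours G v ∪ ⁅ v ⁆ ∣     ≤⟨ ∣p∪q∣≤∣p∣+∣q∣ (neighbours G v) ⁅ v ⁆ ⟩
    degree G v + ∣ ⁅ v ⁆ ∣         ≤⟨ +-mono-≤ (degree≤Δ v∈V) (≤-reflexive (∣⁅x⁆∣≡1 v)) ⟩
    D                              ∎
    where
    open ≤-Reasoning
    p⊆N[v] : p ⊆ neighbours G v ∪ ⁅ v ⁆
    p⊆N[v] {u} u∈p with v ≟ u
    ... | yes refl = q⊆p∪q (neighbours G v) ⁅ v ⁆ (x∈⁅x⁆ v)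
    ... | no v≢u   = p⊆p∪q ⁅ v ⁆ (∈-neighbours⁺ G (v~p u∈p v≢u))

  -- A clique of the largest possible size, as opposed to a maximal one.
  IsMaximumClique : Subset n → Set
  IsMaximumClique C = IsClique G C × ∣ C ∣ ≡ ω G

  isMaximumClique? : ∀ C → Dec (IsMaximumClique C)
  isMaximumClique? C = isClique? G C ×-dec (∣ C ∣ ℕ.≟ ω G)

  maximumCliques : List (Subset n)
  maximumCliques = filter isMaximumClique? (subsets n)

  ∈-maximumCliques⁺ : ∀ {C} → IsMaximumClique C → C List.∈ maximumCliques
  ∈-maximumCliques⁺ = ∈-filter⁺ isMaximumClique? (∈-subsets _)

  ∈-maximumCliques⁻ : ∀ {C} → C List.∈ maximumCliques → IsMaximumClique C
  ∈-maximumCliques⁻ = proj₂ ∘ ∈-filter⁻ isMaximumClique? {xs = subsets n}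

  Meets : Subset n → Subset n → Set
  Meets A B = Nonempty (A ∩ B)

  meets : ∀ {A B v} → v ∈ A → v ∈ B → Meets A B
  meets {v = v} v∈A v∈B = v , x∈p∩q⁺ (v∈A , v∈B)

  Meets-sym : ∀ {A B} → Meets A B → Meets B A
  Meets-sym {A} {B} (v , v∈) = let v∈A , v∈B = x∈p∩q⁻ A B v∈ in meets v∈B v∈A

  -- For the common part P and the union U of the family, and one more maximum
  -- clique A, the set P ∪ (A ∩ U) is again a clique, so it has at most w vertices.
  hajnal : ∀ C Q → All IsMaximumClique (C ∷ Q) →
           ω G + ω G ≤ ∣ ⋂ (C ∷ Q) ∣ + ∣ ⋃ (C ∷ Q) ∣
  hajnal C [] ((_ , ∣C∣≡ω) ∷ []) = ≤-reflexive (sym (cong₂ _+_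
    (trans (cong ∣_∣ (∩-identityʳ C)) ∣C∣≡ω) (trans (cong ∣_∣ (∪-identityʳ C)) ∣C∣≡ω)))
  hajnal A (C ∷ Q) (((A⊆V , A~) , ∣A∣≡ω) ∷ maxQ@(((C⊆V , _) , _) ∷ _)) =
    +-cancelˡ-≤ w _ _ (begin
      w + (w + w)                          ≤⟨ +-monoʳ-≤ w (hajnal C Q maxQ) ⟩
      w + (∣ P ∣ + ∣ U ∣)                  ≡⟨ shuffle₁ w (∣ P ∣) (∣ U ∣) ⟩
      ∣ P ∣ + (w + ∣ U ∣)                  ≡⟨ cong (λ a → ∣ P ∣ + (a + ∣ U ∣)) ∣A∣≡ω ⟨
      ∣ P ∣ + (∣ A ∣ + ∣ U ∣)              ≡⟨ cong (∣ P ∣ +_) (∣p∪q∣+∣p∩q∣≡∣p∣+∣q∣ A U) ⟨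
      ∣ P ∣ + (∣ A ∪ U ∣ + ∣ A ∩ U ∣)      ≡⟨ shuffle₂ (∣ P ∣) (∣ A ∪ U ∣) (∣ A ∩ U ∣) ⟩
      (∣ P ∣ + ∣ A ∩ U ∣) + ∣ A ∪ U ∣      ≡⟨ cong (_+ ∣ A ∪ U ∣) (∣p∪q∣+∣p∩q∣≡∣p∣+∣q∣ P (A ∩ U)) ⟨
      (∣ W ∣ + ∣ P ∩ (A ∩ U) ∣) + ∣ A ∪ U ∣
        ≤⟨ +-monoˡ-≤ ∣ A ∪ U ∣ (+-mono-≤ (ω-upper G W-clique) (p⊆q⇒∣p∣≤∣q∣ P∩A∩U⊆A∩P)) ⟩
      (w + ∣ A ∩ P ∣) + ∣ A ∪ U ∣          ≡⟨ +-assoc w _ _ ⟩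
      w + (∣ A ∩ P ∣ + ∣ A ∪ U ∣)          ∎)
    where
    open ≤-Reasoning
    w = ω G
    P = ⋂ (C ∷ Q)
    U = ⋃ (C ∷ Q)
    W = P ∪ (A ∩ U)

    shuffle₁ : ∀ a b c → a + (b + c) ≡ b + (a + c)
    shuffle₁ = solve-∀
    shuffle₂ : ∀ a b c → a + (b + c) ≡ (a + c) + b
    shuffle₂ = solve-∀

    P⊆U : P ⊆ U
    P⊆U v∈P = ∈-⋃⁺ {ps = C ∷ Q} (here refl) (∈-⋂⁻ {ps = C ∷ Q} v∈P (here refl))

    P~U : ∀ {u v} → u ∈ P → v ∈ U → u ≢ v → u ~ v
    P~U u∈P v∈U u≢v =
      let B , B∈ , v∈B = ∈-⋃⁻ (C ∷ Q) v∈U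
          (_ , B~) , _ = All.lookup maxQ B∈
      in B~ _ _ (∈-⋂⁻ {ps = C ∷ Q} u∈P B∈) v∈B u≢v

    P∩A∩U⊆A∩P : P ∩ (A ∩ U) ⊆ A ∩ P
    P∩A∩U⊆A∩P v∈ = let v∈P , v∈A∩U = x∈p∩q⁻ P (A ∩ U) v∈ in x∈p∩q⁺ (p∩q⊆p A U v∈A∩U , v∈P)

    W⊆V : W ⊆ V
    W⊆V v∈W = [ (λ v∈P → C⊆V (∈-⋂⁻ {ps = C ∷ Q} v∈P (here refl))) , A⊆V ∘ p∩q⊆p A U ]′
              (x∈p∪q⁻ P (A ∩ U) v∈W)

    W~ : ∀ u v → u ∈ W → v ∈ W → u ≢ v → u ~ v
    W~ u v u∈W v∈W u≢v with x∈p∪q⁻ P (A ∩ U) u∈W | x∈p∪q⁻ P (A ∩ U) v∈W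
    ... | inj₁ u∈P | inj₁ v∈P = P~U u∈P (P⊆U v∈P) u≢v
    ... | inj₁ u∈P | inj₂ v∈  = P~U u∈P (p∩q⊆q A U v∈) u≢v
    ... | inj₂ u∈  | inj₁ v∈P = ~-sym (P~U v∈P (p∩q⊆q A U u∈) (u≢v ∘ sym))
    ... | inj₂ u∈  | inj₂ v∈  = A~ u v (p∩q⊆p A U u∈) (p∩q⊆p A U v∈) u≢v

    W-clique : IsClique G W
    W-clique = W⊆V , W~

  -- A common vertex of the family is adjacent to all other vertices of the union.
  ∣⋃∣≤Δ+1 : ∀ C Q → All IsMaximumClique (C ∷ Q) → Nonempty (⋂ (C ∷ Q)) → ∣ ⋃ (C ∷ Q) ∣ ≤ D
  ∣⋃∣≤Δ+1 C Q maxQ (v , v∈⋂) = dominated⇒∣p∣≤Δ+1 (⋃ (C ∷ Q)) v∈V v~⋃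
    where
    v∈V : v ∈ V
    v∈V = proj₁ (proj₁ (All.lookup maxQ (here refl))) (∈-⋂⁻ {ps = C ∷ Q} v∈⋂ (here refl))
    v~⋃ : ∀ {u} → u ∈ ⋃ (C ∷ Q) → v ≢ u → v ~ u
    v~⋃ u∈⋃ v≢u =
      let B , B∈ , u∈B = ∈-⋃⁻ (C ∷ Q) u∈⋃
          (_ , B~) , _ = All.lookup maxQ B∈
      in B~ _ _ (∈-⋂⁻ {ps = C ∷ Q} v∈⋂ B∈) u∈B v≢u

  ⋂-large : ∀ C Q → All IsMaximumClique (C ∷ Q) → Nonempty (⋂ (C ∷ Q)) →
            ω G + ω G ≤ ∣ ⋂ (C ∷ Q) ∣ + D
  ⋂-large C Q maxQ ⋂≢∅ =
    ≤-trans (hajnal C Q maxQ) (+-monoʳ-≤ ∣ ⋂ (C ∷ Q) ∣ (∣⋃∣≤Δ+1 C Q maxQ ⋂≢∅))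

  Meets-large : ∀ {A B} → IsMaximumClique A → IsMaximumClique B → Meets A B →
                ω G + ω G ≤ ∣ A ∩ B ∣ + D
  Meets-large {A} {B} maxA maxB A∩B≢∅ =
    subst (λ p → ω G + ω G ≤ ∣ p ∣ + D) A∩B≡
      (⋂-large A (B ∷ []) (maxA ∷ maxB ∷ []) (subst Nonempty (sym A∩B≡) A∩B≢∅))
    where
    A∩B≡ : ⋂ (A ∷ B ∷ []) ≡ A ∩ B
    A∩B≡ = cong (A ∩_) (∩-identityʳ B)

  -- Edges outside maximum cliques

  ShareMaximumClique : Fin n → Fin n → Set
  ShareMaximumClique u v = ∃[ C ] IsMaximumClique C × u ∈ C × v ∈ C

  -- The graph with the edges of G that lie in no maximum clique.
  outerGraph : Graph n
  outerGraph = record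
    { V        = V
    ; _~_      = λ u v → u ~ v × ¬ ShareMaximumClique u v
    ; _~?_     = λ u v → (u ~? v) ×-dec
                   ¬? (anySubset? λ C → isMaximumClique? C ×-dec ((u ∈? C) ×-dec (v ∈? C)))
    ; ~-sym    = λ (u~v , ¬uv) → ~-sym u~v , λ (C , maxC , v∈C , u∈C) → ¬uv (C , maxC , u∈C , v∈C)
    ; ~-irrefl = ~-irrefl ∘ proj₁
    ; ~⇒∈V     = ~⇒∈V ∘ proj₁
    }

  -- The neighbours of v in the outer graph and the clique C are disjoint, and v
  -- is adjacent in G to all of them except itself.
  outerDegree : ∀ {C v} → IsMaximumClique C → v ∈ C → degree outerGraph v + ω G ≤ D
  outerDegree {C} {v} maxC@((C⊆V , C~) , ∣C∣≡ω) v∈C = begin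
    degree outerGraph v + ω G    ≡⟨ cong (∣ N ∣ +_) ∣C∣≡ω ⟨
    ∣ N ∣ + ∣ C ∣                ≡⟨ disjoint⇒∣p∪q∣≡∣p∣+∣q∣ N C N#C ⟨
    ∣ N ∪ C ∣                    ≤⟨ dominated⇒∣p∣≤Δ+1 (N ∪ C) (C⊆V v∈C) v~ ⟩
    D                            ∎
    where
    open ≤-Reasoning
    N = neighbours outerGraph v
    N#C : ∀ {u} → u ∈ N → u ∉ C
    N#C u∈N u∈C = proj₂ (∈-neighbours⁻ outerGraph u∈N) (C , maxC , v∈C , u∈C)
    v~ : ∀ {u} → u ∈ N ∪ C → v ≢ u → v ~ u
    v~ u∈ v≢u = [ proj₁ ∘ ∈-neighbours⁻ outerGraph , (λ u∈C → C~ _ _ v∈C u∈C v≢u) ]′ (x∈p∪q⁻ N C u∈)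

  -- A clique of G - I as large as the clique number of G would be a maximum clique of G
  -- missing I.
  hitting⇒ω< : ∀ I → (∀ {C} → IsMaximumClique C → Meets C I) → ω (G - I) < ω G
  hitting⇒ω< I hits with ω-attained (G - I)
  ... | C , (C⊆V─I , C~) , ∣C∣≡ω′ =
    ≤∧≢⇒< (subst (_≤ ω G) ∣C∣≡ω′ (ω-upper G C-clique)) λ ω′≡ω →
      let v , v∈ = hits (C-clique , trans ∣C∣≡ω′ ω′≡ω)
          v∈C , v∈I = x∈p∩q⁻ C I v∈
      in x∈p─q⇒x∉q (C⊆V─I v∈C) v∈I
    where
    C-clique : IsClique G C
    C-clique = p─q⊆p V I ∘ C⊆V─I , λ u v u∈C v∈C u≢v → proj₁ (C~ u v u∈C v∈C u≢v)

  -- Classes of meeting maximum cliques and their kernels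

  module Dense (2D<3ω : D + D < ω G + ω G + ω G) where

    -- Both intersections lie in B and have more than w / 2 vertices, so they overlap.
    Meets-trans : ∀ {A B C} → IsMaximumClique A → IsMaximumClique B → IsMaximumClique C →
                  Meets A B → Meets B C → Meets A C
    Meets-trans {A} {B} {C} maxA maxB@(_ , ∣B∣≡ω) maxC AB BC =
      let v , v∈ = 0<∣p∣⇒Nonempty (p ∩ q) 0<∣p∩q∣
          v∈p , v∈q = x∈p∩q⁻ p q v∈
      in meets (p∩q⊆p A B v∈p) (p∩q⊆q B C v∈q)
      where
      open ≤-Reasoning
      p = A ∩ B
      q = B ∩ C
      w = ω G
      p∪q⊆B : p ∪ q ⊆ B
      p∪q⊆B v∈ = [ p∩q⊆q A B , p∩q⊆p B C ]′ (x∈p∪q⁻ p q v∈)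
      shuffle₁ : ∀ w D → (D + D) + w + 1 ≡ 1 + (D + D) + w
      shuffle₁ = solve-∀
      shuffle₂ : ∀ w → w + w + w + w ≡ (w + w) + (w + w)
      shuffle₂ = solve-∀
      shuffle₃ : ∀ a b D → (a + D) + (b + D) ≡ (a + b) + (D + D)
      shuffle₃ = solve-∀
      shuffle₄ : ∀ w m D → (w + m) + (D + D) ≡ (D + D) + w + m
      shuffle₄ = solve-∀
      0<∣p∩q∣ : 0 < ∣ p ∩ q ∣
      0<∣p∩q∣ = +-cancelˡ-≤ ((D + D) + w) 1 _ (begin
        (D + D) + w + 1                    ≡⟨ shuffle₁ w D ⟩
        suc (D + D) + w                    ≤⟨ +-monoˡ-≤ w 2D<3ω ⟩
        w + w + w + w                      ≡⟨ shuffle₂ w ⟩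
        (w + w) + (w + w)                  ≤⟨ +-mono-≤ (Meets-large maxA maxB AB) (Meets-large maxB maxC BC) ⟩
        (∣ p ∣ + D) + (∣ q ∣ + D)          ≡⟨ shuffle₃ (∣ p ∣) (∣ q ∣) D ⟩
        (∣ p ∣ + ∣ q ∣) + (D + D)          ≡⟨ cong (_+ (D + D)) (∣p∪q∣+∣p∩q∣≡∣p∣+∣q∣ p q) ⟨
        (∣ p ∪ q ∣ + ∣ p ∩ q ∣) + (D + D)
          ≤⟨ +-monoˡ-≤ (D + D) (+-monoˡ-≤ (∣ p ∩ q ∣) (≤-trans (p⊆q⇒∣p∣≤∣q∣ p∪q⊆B) (≤-reflexive ∣B∣≡ω))) ⟩
        (w + ∣ p ∩ q ∣) + (D + D)          ≡⟨ shuffle₄ w (∣ p ∩ q ∣) D ⟩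
        (D + D) + w + ∣ p ∩ q ∣            ∎)

    0<ω : 0 < ω G
    0<ω = n≢0⇒n>0 λ ω≡0 → n≮0 (subst (λ w → D + D < w + w + w) ω≡0 2D<3ω)

    IsMaximumClique⇒Nonempty : ∀ {C} → IsMaximumClique C → Nonempty C
    IsMaximumClique⇒Nonempty {C} (_ , ∣C∣≡ω) = 0<∣p∣⇒Nonempty C (subst (0 <_) (sym ∣C∣≡ω) 0<ω)

    ω≤Δ+1 : ω G ≤ D
    ω≤Δ+1 =
      let C , (C⊆V , C~) , ∣C∣≡ω = ω-attained G
          v , v∈C = IsMaximumClique⇒Nonempty ((C⊆V , C~) , ∣C∣≡ω)
      in subst (_≤ D) ∣C∣≡ω (dominated⇒∣p∣≤Δ+1 C (C⊆V v∈C) (C~ _ _ v∈C))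

    -- A further clique A shares at least 2w - D vertices with the union of the
    -- family, which has at most D vertices.  So the new union has at most
    -- 2D - w < 2w vertices, and the new common part is nonempty by Hajnal's inequality.
    ⋂-nonempty : ∀ C Q → All IsMaximumClique (C ∷ Q) →
                 (∀ {A B} → A List.∈ C ∷ Q → B List.∈ C ∷ Q → Meets A B) → Nonempty (⋂ (C ∷ Q))
    ⋂-nonempty C [] (maxC ∷ []) _ =
      subst Nonempty (sym (∩-identityʳ C)) (IsMaximumClique⇒Nonempty maxC)
    ⋂-nonempty A (C ∷ Q) max@(maxA@(_ , ∣A∣≡ω) ∷ maxQ@(maxC ∷ _)) meet =
      0<∣p∣⇒Nonempty (⋂ (A ∷ C ∷ Q)) (+-cancelˡ-≤ ((D + D) + (w + w)) 1 _ (begin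
        (D + D) + (w + w) + 1                ≡⟨ shuffle₁ w D ⟩
        suc (D + D) + (w + w)                ≤⟨ +-monoˡ-≤ (w + w) 2D<3ω ⟩
        w + w + w + (w + w)                  ≡⟨ shuffle₂ w ⟩
        (w + w) + (w + w) + w                ≤⟨ +-monoˡ-≤ w (+-mono-≤ ∩-large (hajnal A (C ∷ Q) max)) ⟩
        (a + D) + (m + ∣ A ∪ U ∣) + w        ≡⟨ shuffle₃ a D m (∣ A ∪ U ∣) w ⟩
        (∣ A ∪ U ∣ + a) + (D + m + w)        ≤⟨ +-monoˡ-≤ (D + m + w) union ⟩
        (w + D) + (D + m + w)                ≡⟨ shuffle₄ w D m ⟩
        (D + D) + (w + w) + m                ∎))
      where
      open ≤-Reasoning
      w = ω G
      U = ⋃ (C ∷ Q)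
      a = ∣ A ∩ U ∣
      m = ∣ ⋂ (A ∷ C ∷ Q) ∣
      shuffle₁ : ∀ w D → (D + D) + (w + w) + 1 ≡ 1 + (D + D) + (w + w)
      shuffle₁ = solve-∀
      shuffle₂ : ∀ w → w + w + w + (w + w) ≡ (w + w) + (w + w) + w
      shuffle₂ = solve-∀
      shuffle₃ : ∀ a D m u w → (a + D) + (m + u) + w ≡ (u + a) + (D + m + w)
      shuffle₃ = solve-∀
      shuffle₄ : ∀ w D m → (w + D) + (D + m + w) ≡ (D + D) + (w + w) + m
      shuffle₄ = solve-∀
      C⊆U : C ⊆ U
      C⊆U = p⊆p∪q (⋃ Q)
      ∩-large : w + w ≤ a + D
      ∩-large = ≤-trans (Meets-large maxA maxC (meet (here refl) (there (here refl))))
        (+-monoˡ-≤ D (p⊆q⇒∣p∣≤∣q∣ λ v∈ → let v∈A , v∈C = x∈p∩q⁻ A C v∈ in x∈p∩q⁺ (v∈A , C⊆U v∈C)))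
      union : ∣ A ∪ U ∣ + a ≤ w + D
      union = ≤-trans (≤-reflexive (trans (∣p∪q∣+∣p∩q∣≡∣p∣+∣q∣ A U) (cong (_+ ∣ U ∣) ∣A∣≡ω)))
        (+-monoʳ-≤ w (∣⋃∣≤Δ+1 C Q maxQ (⋂-nonempty C Q maxQ λ B∈ B′∈ → meet (there B∈) (there B′∈))))

    -- The maximum cliques that meet C: its class, when C is a maximum clique.
    meeting : Subset n → List (Subset n)
    meeting C = filter (λ B → nonempty? (C ∩ B)) maximumCliques

    -- The common part of the class of C.  Listing C itself once more makes the
    -- family nonempty for every C.
    kernel : Subset n → Subset n
    kernel C = ⋂ (C ∷ meeting C)

    kernel⊆ : ∀ {B C} → IsMaximumClique B → Meets C B → kernel C ⊆ B
    kernel⊆ {B} {C} maxB C∩B≢∅ v∈ = ∈-⋂⁻ {ps = C ∷ meeting C} v∈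
      (there (∈-filter⁺ (λ B → nonempty? (C ∩ B)) (∈-maximumCliques⁺ maxB) C∩B≢∅))

    kernel⊆self : ∀ C → kernel C ⊆ C
    kernel⊆self C = p∩q⊆p C (⋂ (meeting C))

    kernel-large : ∀ {C} → IsMaximumClique C → ω G + ω G ≤ ∣ kernel C ∣ + D
    kernel-large {C} maxC = ⋂-large C (meeting C) allMax (⋂-nonempty C (meeting C) allMax pairwise)
      where
      meeting⁻ : ∀ {B} → B List.∈ meeting C → IsMaximumClique B × Meets C B
      meeting⁻ B∈ =
        let B∈max , CB = ∈-filter⁻ (λ B → nonempty? (C ∩ B)) {xs = maximumCliques} B∈
        in ∈-maximumCliques⁻ B∈max , CB
      meetsC : ∀ {B} → B List.∈ C ∷ meeting C → IsMaximumClique B × Meets C B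
      meetsC (here refl) = let v , v∈C = IsMaximumClique⇒Nonempty maxC in maxC , meets v∈C v∈C
      meetsC (there B∈)  = meeting⁻ B∈
      allMax : All IsMaximumClique (C ∷ meeting C)
      allMax = All.tabulate (proj₁ ∘ meetsC)
      pairwise : ∀ {A B} → A List.∈ C ∷ meeting C → B List.∈ C ∷ meeting C → Meets A B
      pairwise A∈ B∈ =
        let maxA , CA = meetsC A∈
            maxB , CB = meetsC B∈
        in Meets-trans maxA maxC maxB (Meets-sym CA) CB

    -- A transversal of the kernels as a hitting set

    module _ (reps : Representatives Meets maximumCliques) where
      open Representatives reps renaming (size to c; rep to C)

      C-maximum : ∀ i → IsMaximumClique (C i)
      C-maximum i = ∈-maximumCliques⁻ (rep∈ i)

      kernel-disjoint : ∀ {i j v} → i ≢ j → v ∈ kernel (C i) → v ∉ kernel (C j)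
      kernel-disjoint i≢j v∈Ki v∈Kj =
        unrelated i≢j (meets (kernel⊆self (C _) v∈Ki) (kernel⊆self (C _) v∈Kj))

      transversal⇒hittingSet :
        (T : Fin c → Fin n) → (∀ i → T i ∈ kernel (C i)) →
        (∀ i j → ¬ (Graph._~_ outerGraph (T i) (T j))) →
        ∃[ I ] IsIndependent G I × ω (G - I) < ω G
      transversal⇒hittingSet T T∈kernel T-outer =
        I , (I⊆V , I-independent) , hitting⇒ω< I I-hits
        where
        T∈C : ∀ i → T i ∈ C i
        T∈C i = kernel⊆self (C i) (T∈kernel i)

        -- An edge between T i and T j would lie in a maximum clique meeting both C i and
        -- C j, which belong to different classes.
        T-independent : ∀ i j → ¬ (T i ~ T j)
        T-independent i j Ti~Tj with i ≟ j
        ... | yes refl = ~-irrefl Ti~Tj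
        ... | no i≢j   = T-outer i j (Ti~Tj , λ (B , maxB , Ti∈B , Tj∈B) →
          unrelated i≢j (Meets-trans (C-maximum i) maxB (C-maximum j)
            (meets (T∈C i) Ti∈B) (meets Tj∈B (T∈C j))))

        I : Subset n
        I = ⋃ (map (⁅_⁆ ∘ T) (allFin c))

        ∈I⁺ : ∀ i → T i ∈ I
        ∈I⁺ i = ∈-⋃⁺ (∈-map⁺ (⁅_⁆ ∘ T) (∈-allFin i)) (x∈⁅x⁆ (T i))

        ∈I⁻ : ∀ {v} → v ∈ I → ∃[ i ] v ≡ T i
        ∈I⁻ v∈I =
          let i , _ , v∈⁅Ti⁆ = ∈-⋃-map⁻ (⁅_⁆ ∘ T) (allFin c) v∈I in i , x∈⁅y⁆⇒x≡y (T i) v∈⁅Ti⁆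

        I⊆V : I ⊆ V
        I⊆V v∈I with ∈I⁻ v∈I
        ... | i , refl = proj₁ (proj₁ (C-maximum i)) (T∈C i)

        I-independent : ∀ u v → u ∈ I → v ∈ I → ¬ (u ~ v)
        I-independent u v u∈I v∈I with ∈I⁻ u∈I | ∈I⁻ v∈I
        ... | i , refl | j , refl = T-independent i j

        I-hits : ∀ {B} → IsMaximumClique B → Meets B I
        I-hits maxB =
          let i , CiB = covers (∈-maximumCliques⁺ maxB)
          in meets (kernel⊆ maxB CiB (T∈kernel i)) (∈I⁺ i)

    hittingIndependentSet : 3 * D ≤ 4 * ω G →
                            ∃[ I ] IsIndependent G I × ω (G - I) < ω G
    hittingIndependentSet 3D≤4ω =
      let T , T∈kernel , T-outer = Transversals.independentTransversal
            outerGraph (kernel ∘ C) (kernel-disjoint reps) (D ∸ ω G) ((ω G + ω G) ∸ D)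
            (2[D∸w]≤2w∸D {ω G} ω≤Δ+1 3D≤4ω) (0<2w∸D {ω G} ω≤Δ+1 2D<3ω)
            (λ i → m≤n+o⇒m∸n≤o (ω G + ω G) D
              (≤-trans (kernel-large (C-maximum reps i)) (≤-reflexive (+-comm ∣ kernel (C i) ∣ D))))
            (λ {i} v∈K → m+n≤o⇒m≤o∸n _ (outerDegree (C-maximum reps i) (kernel⊆self (C i) v∈K)))
      in transversal⇒hittingSet reps T T∈kernel T-outer
      where
      Meets-refl : ∀ {C} → C List.∈ maximumCliques → Meets C C
      Meets-refl C∈ =
        let v , v∈C = IsMaximumClique⇒Nonempty (∈-maximumCliques⁻ C∈) in meets v∈C v∈C

      reps : Representatives Meets maximumCliques
      reps = representatives (λ A B → nonempty? (A ∩ B)) Meets-sym maximumCliques Meets-refl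

      open Representatives reps renaming (rep to C)

mainTheorem1 : ∀ {n : ℕ} (G : Graph n) →
    4 * ω G ≥ 3 * (Δ G + 1) →
    ∃[ I ] IsIndependent G I × ω (G - I) < ω G
mainTheorem1 G 3D≤4ω = hittingIndependentSet 3D≤4ω
  where
  open MaximumCliques G
  open Dense (3D≤4w⇒2D<3w {ω G} (m≤n+m 1 (Δ G)) 3D≤4ω)
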